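{- The only graphs $G$ (of order $n$) with skew zero forcing polynomial $\mathcal{Z}^-(G;x)=\sum_{i=0}^n \binom{n}{i}x^i=(x+1)^n$ are the two-set perfectly orderable graphs; that is, $\mathcal{Z}^-(G;x)=(x+1)^n$ if and only if $G$ is two-set perfectly orderable.
   Context: Graphs are finite, simple (no loops or multiple edges), undirected; $n=|V(G)|$ is the order of $G$. Skew zero forcing: a subset $S\subseteq V(G)$ (possibly empty) is colored blue and all other vertices white. Skew color change rule: if any vertex (blue or white) has exactly one white neighbor, then that white neighbor becomes blue. $S$ is a skew zero forcing set if repeated application of the rule eventually turns all vertices blue. The skew zero forcing polynomial is $\mathcal{Z}^-(G;x)=\sum_{i=0}^n z^-(G;i)x^i$, where $z^-(G;i)$ is the number of skew zero forcing sets of $G$ of cardinality $i$. A graph $G$ is two-set perfectly orderable if (1) $V(G)$ can be partitioned into ordered sets $U=\{u_1,\ldots,u_m\}$ and $W=\{w_1,\ldots,w_m\}$ such that $u_i v\in E(G)$ only if $v=w_j$ for some $j\le i$, and (2) $u_iw_i\in E(G)$ for all $i\in\{1,\ldots,m\}$. -}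

module Defs where

open import Algebra.Bundles.Raw using (RawSemiring)
open import Data.Bool.Properties using () renaming (_≟_ to _≟ᵇ_)
open import Data.Fin.Base using (Fin; toℕ; _≤_)
open import Data.Fin.Properties using (all?; any?; _≟_)
open import Data.Fin.Subset
open import Data.Fin.Subset.Induction using (⊃-wellFounded)
open import Data.Fin.Subset.Properties using (_∈?_; p⊆p∪q; q⊆p∪q; x∈⁅x⁆)
open import Data.List.Base using (List; []; _∷_; [_]; _++_; length; filter)
  renaming (map to mapᴸ)
open import Data.Nat.Base as ℕ using (ℕ; zero; suc)
open import Data.Nat.Properties using () renaming (_≟_ to _≟ⁿ_)
open import Data.Product.Base using (∃; ∃₂; _×_; _,_)
open import Data.Sum.Base using (_⊎_; [_,_]′)
open import Data.Vec.Base using ([]; _∷_)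
open import Data.Vec.Properties using (≡-dec)
open import Function.Definitions using (Bijective)
open import Induction.WellFounded using (Acc; acc)
open import Level using (0ℓ)
open import Relation.Binary.Core using (Rel)
open import Relation.Binary.Construct.Closure.ReflexiveTransitive
  using (Star; ε; _◅_)
open import Relation.Binary.Definitions
  using (Decidable; Symmetric; Irreflexive)
open import Relation.Binary.PropositionalEquality.Core using (_≡_; refl)
open import Relation.Nullary.Decidable
  using (Dec; yes; no; map′; ¬?; _×-dec_; _→-dec_)
open import Relation.Nullary.Negation.Core using (contradiction)

record Graph (n : ℕ) : Set₁ where
  infix 4 _~_ _~?_
  field
    _~_    : Rel (Fin n) 0ℓ
    _~?_   : Decidable _~_
    sym    : Symmetric _~_
    irrefl : Irreflexive _≡_ _~_

module _ {n : ℕ} (G : Graph n) where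
  open Graph G

  -- S is the set of blue vertices, and w is the unique white neighbour of v.
  -- No colour is required of v: this is what makes the rule the skew one.

  Forces : Subset n → Fin n → Fin n → Set
  Forces S v w = v ~ w × w ∉ S × (∀ x → v ~ x → x ∉ S → x ≡ w)

  data Step (S : Subset n) : Subset n → Set where
    step : ∀ {v w} → Forces S v w → Step S (S ∪ ⁅ w ⁆)

  SkewZeroForcing : Subset n → Set
  SkewZeroForcing S = Star Step S ⊤

  forces? : ∀ S v w → Dec (Forces S v w)
  forces? S v w =
    (v ~? w) ×-dec ¬? (w ∈? S) ×-dec
    all? (λ x → (v ~? x) →-dec (¬? (x ∈? S) →-dec (x ≟ w)))

  private
    grows : ∀ (S : Subset n) {w} → w ∉ S → S ⊂ S ∪ ⁅ w ⁆
    grows S {w} w∉S = p⊆p∪q ⁅ w ⁆ , w , q⊆p∪q S ⁅ w ⁆ (x∈⁅x⁆ w) , w∉S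

    search : ∀ S → Acc _⊃_ S → Dec (SkewZeroForcing S)
    search S (acc rec) with ≡-dec _≟ᵇ_ S ⊤
    ... | yes refl = yes ε
    ... | no S≢⊤ = map′ to from (any? λ v → any? λ w → forceThen? v w)
      where
      ForceThen : Fin n → Fin n → Set
      ForceThen v w = Forces S v w × SkewZeroForcing (S ∪ ⁅ w ⁆)

      forceThen? : ∀ v w → Dec (ForceThen v w)
      forceThen? v w with forces? S v w
      ... | no ¬f = no λ (f , _) → ¬f f
      ... | yes f@(_ , w∉S , _) =
        map′ (f ,_) (λ (_ , r) → r)
             (search (S ∪ ⁅ w ⁆) (rec (grows S w∉S)))

      to : ∃₂ ForceThen → SkewZeroForcing S
      to (_ , _ , f , r) = step f ◅ r

      from : SkewZeroForcing S → ∃₂ ForceThen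
      from ε            = contradiction refl S≢⊤
      from (step f ◅ r) = _ , _ , f , r

  skewZeroForcing? : ∀ S → Dec (SkewZeroForcing S)
  skewZeroForcing? S = search S (⊃-wellFounded S)

  record TwoSetPerfectlyOrderable : Set where
    field
      {m}       : ℕ
      u w       : Fin m → Fin n
      partition : Bijective _≡_ _≡_ [ u , w ]′
      u-nbrs    : ∀ i v → u i ~ v → ∃ λ j → j ≤ i × v ≡ w j
      matched   : ∀ i → u i ~ w i

allSubsets : ∀ n → List (Subset n)
allSubsets zero    = [ [] ]
allSubsets (suc n) =
  mapᴸ (outside ∷_) (allSubsets n) ++ mapᴸ (inside ∷_) (allSubsets n)

z⁻ : ∀ {n} → Graph n → ℕ → ℕ
z⁻ {n} G i =
  length (filter (λ S → skewZeroForcing? G S ×-dec (∣ S ∣ ≟ⁿ i)) (allSubsets n))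

-- Formal polynomials over ℕ, as coefficient lists with the constant term
-- first.  Trailing zeros are permitted, so equality is coefficientwise.

Poly : Set
Poly = List ℕ

coeff : Poly → ℕ → ℕ
coeff []      _       = 0
coeff (a ∷ p) zero    = a
coeff (a ∷ p) (suc k) = coeff p k

infix  4 _≈_
infixl 6 _+_
infixl 7 _*_

_≈_ : Rel Poly 0ℓ
p ≈ q = ∀ k → coeff p k ≡ coeff q k

_+_ : Poly → Poly → Poly
[]      + q       = q
(a ∷ p) + []      = a ∷ p
(a ∷ p) + (b ∷ q) = (a ℕ.+ b) ∷ (p + q)

_*_ : Poly → Poly → Poly
[]      * q = []
(a ∷ p) * q = mapᴸ (a ℕ.*_) q + (0 ∷ (p * q))

const : ℕ → Poly
const a = [ a ]

X : Poly
X = 0 ∷ 1 ∷ []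

polyRawSemiring : RawSemiring 0ℓ 0ℓ
polyRawSemiring = record
  { Carrier = Poly ; _≈_ = _≈_ ; _+_ = _+_ ; _*_ = _*_
  ; 0# = [] ; 1# = const 1 }

open import Algebra.Definitions.RawSemiring polyRawSemiring public
  using (_^_; sum)

∑[_]_Xⁱ : ℕ → (ℕ → ℕ) → Poly
∑[ n ] a Xⁱ = sum {suc n} λ i → const (a (toℕ i)) * X ^ toℕ i

𝒵⁻ : ∀ {n} → Graph n → Poly
𝒵⁻ {n} G = ∑[ n ] z⁻ G Xⁱ

{-# OPTIONS --safe #-}

-- Call a nonempty T a fort if no vertex has exactly one neighbour in T.  The
-- complement of a stalled set is a fort, so ∅ is skew zero forcing iff there is
-- no fort, and then every set is skew zero forcing.
--
-- If there is no fort, then some v has a unique neighbour w in the whole graph.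
-- Deleting v and w creates no fort: a fort T of the rest would give the fort T
-- or T ∪ {v} of the original graph.  Taking v and w as u₁ and w₁ and iterating
-- produces the ordering.  Conversely, in an ordered graph u_i singles out the
-- least w_i in T, and if T contains no w_i then w_i singles out the greatest
-- u_i in T.

module Submission where

open import Defs
open import Data.Bool.Base using (true; false)
open import Data.Fin.Base using (Fin; zero; suc; toℕ; _≤_; _<_; _>_)
open import Data.Fin.Induction using (<-wellFounded; >-wellFounded)
open import Data.Fin.Properties using (any?; _≟_; _<?_; ≤∧≢⇒<)
open import Data.Fin.Subset
  using (Subset; Nonempty; inside; outside; _∈_; _∉_; _⊆_; _⊂_; _⊃_; _∪_; _-_;
         ⁅_⁆; ∁; ⊤; ∣_∣)
open import Data.Fin.Subset.Induction using (⊂-wellFounded; ⊃-wellFounded)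
open import Data.Fin.Subset.Properties
open import Data.List.Base using (List; []; _∷_; length; filter; map)
open import Data.List.Membership.Propositional using ()
  renaming (_∈_ to _∈ᴸ_)
open import Data.List.Membership.Propositional.Properties using (∈-filter⁻)
open import Data.List.Properties
  using (filter-++; filter-≐; filter-none; length-++)
open import Data.List.Relation.Unary.All using (universal)
open import Data.List.Relation.Unary.Any using (here)
open import Data.Nat.Base as ℕ using (ℕ; zero; suc; z≤n; s≤s)
open import Data.Nat.Combinatorics
  using (_C_; k>n⇒nCk≡0; nCk+nC[k+1]≡[n+1]C[k+1])
import Data.Nat.Properties as ℕ
open import Data.Product.Base using (∃; ∃₂; _×_; _,_; proj₁; proj₂)
open import Data.Sum.Base using (inj₁; inj₂; [_,_]′)
open import Data.Vec.Base using (here; there) renaming (_∷_ to _∷ᵛ_)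
open import Data.Vec.Functional using (Vector) renaming (_∷_ to _∷ᶠ_)
open import Function.Base using (_∘_)
open import Function.Bundles using (_⇔_; mk⇔)
open import Function.Definitions using (Injective)
open import Induction.WellFounded using (Acc; acc)
import Relation.Binary.Construct.Closure.ReflexiveTransitive as Star
open import Relation.Binary.PropositionalEquality
  using (_≡_; _≢_; refl; sym; trans; cong; cong₂; subst)
open import Relation.Nullary.Decidable using (yes; no; does; _×-dec_)
open import Relation.Nullary.Negation using (¬_; contradiction)
open import Relation.Unary using (Decidable)

-- Coefficients of sums, products and powers of polynomials.

coeff-+ : ∀ p q k → coeff (p + q) k ≡ coeff p k ℕ.+ coeff q k
coeff-+ []      q       k       = refl
coeff-+ (a ∷ p) []      k       = sym (ℕ.+-identityʳ _)
coeff-+ (a ∷ p) (b ∷ q) zero    = refl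
coeff-+ (a ∷ p) (b ∷ q) (suc k) = coeff-+ p q k

coeff-map-* : ∀ c p k → coeff (map (c ℕ.*_) p) k ≡ c ℕ.* coeff p k
coeff-map-* c []      k       = sym (ℕ.*-zeroʳ c)
coeff-map-* c (a ∷ p) zero    = refl
coeff-map-* c (a ∷ p) (suc k) = coeff-map-* c p k

coeff-∷-* : ∀ a p q k →
  coeff ((a ∷ p) * q) k ≡ a ℕ.* coeff q k ℕ.+ coeff (0 ∷ p * q) k
coeff-∷-* a p q k = trans (coeff-+ (map (a ℕ.*_) q) _ k)
                          (cong (ℕ._+ _) (coeff-map-* a q k))

coeff-0∷[] : ∀ k → coeff (0 ∷ []) k ≡ 0
coeff-0∷[] zero    = refl
coeff-0∷[] (suc k) = refl

coeff-const-* : ∀ c p k → coeff (const c * p) k ≡ c ℕ.* coeff p k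
coeff-const-* c p k = trans (coeff-∷-* c [] p k)
  (trans (cong (c ℕ.* coeff p k ℕ.+_) (coeff-0∷[] k)) (ℕ.+-identityʳ _))

const-1-* : ∀ p → const 1 * p ≈ p
const-1-* p k = trans (coeff-const-* 1 p k) (ℕ.*-identityˡ _)

X-* : ∀ p → X * p ≈ 0 ∷ p
X-* p zero    = coeff-∷-* 0 (1 ∷ []) p 0
X-* p (suc k) = trans (coeff-∷-* 0 (1 ∷ []) p (suc k)) (const-1-* p k)

const-*-X-* : ∀ c p → const c * (X * p) ≈ 0 ∷ const c * p
const-*-X-* c p k = trans (coeff-const-* c (X * p) k) (lemma k)
  where
  lemma : ∀ k → c ℕ.* coeff (X * p) k ≡ coeff (0 ∷ const c * p) k
  lemma zero    = trans (cong (c ℕ.*_) (X-* p 0)) (ℕ.*-zeroʳ c)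
  lemma (suc k) = trans (cong (c ℕ.*_) (X-* p (suc k)))
                        (sym (coeff-const-* c p k))

-- Takes a common factor `X`, in the form of a shift, out of a whole sum. The empty sums `[]` and
-- `0 ∷ []` differ as lists and agree only up to `≈`.
sum-0∷ : ∀ m (f g : Vector Poly m) → (∀ i → f i ≈ 0 ∷ g i) →
         sum f ≈ 0 ∷ sum g
sum-0∷ zero    f g f≈0∷g k = sym (coeff-0∷[] k)
sum-0∷ (suc m) f g f≈0∷g k = trans (coeff-+ (f zero) _ k)
  (trans (cong₂ ℕ._+_ (f≈0∷g zero k) (sum-0∷ m _ _ (f≈0∷g ∘ suc) k))
         (sym (coeff-+ (0 ∷ g zero) (0 ∷ sum (g ∘ suc)) k)))

-- Induction on `m`: all terms but the first share a factor `X`, so they form the shift of a shorter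
-- sum with coefficients `a ∘ suc`. The hypothesis covers the degrees that the `m` terms do not
-- reach.
coeff-sum : ∀ m (a : ℕ → ℕ) k → (m ℕ.≤ k → a k ≡ 0) →
  coeff (sum {m} λ i → const (a (toℕ i)) * X ^ toℕ i) k ≡ a k
coeff-sum zero    a k a≡0 = sym (a≡0 z≤n)
coeff-sum (suc m) a k a≡0 = trans (coeff-+ (const (a 0) * X ^ 0) X*tail k)
  (trans (cong (coeff (const (a 0) * X ^ 0) k ℕ.+_) (tail-shift k))
         (lemma k a≡0))
  where
  tail : Poly
  tail = sum {m} λ i → const (a (suc (toℕ i))) * X ^ toℕ i

  X*tail : Poly
  X*tail = sum {m} λ i → const (a (suc (toℕ i))) * X ^ suc (toℕ i)

  tail-shift : X*tail ≈ 0 ∷ tail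
  tail-shift = sum-0∷ m _ _ λ i → const-*-X-* (a (suc (toℕ i))) (X ^ toℕ i)

  lemma : ∀ k → (suc m ℕ.≤ k → a k ≡ 0) →
          coeff (const (a 0) * X ^ 0) k ℕ.+ coeff (0 ∷ tail) k ≡ a k
  -- `const (a 0) * X ^ 0` computes to the one-entry list with entry `a 0 ℕ.* 1 ℕ.+ 0`, so it
  -- contributes in degree 0 only.
  lemma zero    _   = trans (ℕ.+-identityʳ _)
    (trans (ℕ.+-identityʳ _) (ℕ.*-identityʳ _))
  lemma (suc k) a≡0 = coeff-sum m (a ∘ suc) k (a≡0 ∘ s≤s)

binomial : ∀ n k → coeff ((X + const 1) ^ n) k ≡ n C k
binomial zero    zero    = refl
binomial zero    (suc k) = sym (k>n⇒nCk≡0 {0} {suc k} (s≤s z≤n))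
-- `X + const 1` computes to `1 ∷ 1 ∷ []`, so multiplying by it adds `p` to its shift, which is
-- Pascal's rule.
binomial (suc n) k = trans (coeff-∷-* 1 (1 ∷ []) p k) (lemma k)
  where
  p : Poly
  p = (X + const 1) ^ n

  lemma : ∀ k → 1 ℕ.* coeff p k ℕ.+ coeff (0 ∷ const 1 * p) k ≡ suc n C k
  lemma zero    = trans (ℕ.+-identityʳ _)
    (trans (ℕ.*-identityˡ _) (binomial n 0))
  lemma (suc k) = trans
    (cong₂ ℕ._+_ (trans (ℕ.*-identityˡ _) (binomial n (suc k)))
                 (trans (const-1-* p k) (binomial n k)))
    (trans (ℕ.+-comm (n C suc k) (n C k)) (nCk+nC[k+1]≡[n+1]C[k+1] n k))

∑-≈-binomial : ∀ n (a : ℕ → ℕ) → (∀ k → a k ≡ n C k) →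
               ∑[ n ] a Xⁱ ≈ (X + const 1) ^ n
∑-≈-binomial n a a≡C k = trans
  -- The sum has `suc n` terms, so vanishing is required for `n < k`, where the binomial coefficient
  -- is 0.
  (coeff-sum (suc n) a k λ n<k → trans (a≡C k) (k>n⇒nCk≡0 n<k))
  (trans (a≡C k) (sym (binomial n k)))

-- Counting subsets by cardinality.

length-filter-map : ∀ {A B : Set} {P : B → Set} (P? : Decidable P)
  (f : A → B) xs →
  length (filter P? (map f xs)) ≡ length (filter (P? ∘ f) xs)
length-filter-map P? f []       = refl
length-filter-map P? f (x ∷ xs) with does (P? (f x))
... | true  = cong suc (length-filter-map P? f xs)
... | false = length-filter-map P? f xs

length-filter-allSubsets : ∀ n k →
  length (filter (λ S → ∣ S ∣ ℕ.≟ k) (allSubsets n)) ≡ n C k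
length-filter-allSubsets zero    zero    = refl
length-filter-allSubsets zero    (suc k) =
  sym (k>n⇒nCk≡0 {0} {suc k} (s≤s z≤n))
length-filter-allSubsets (suc n) k = trans
  (cong length (filter-++ (λ S → ∣ S ∣ ℕ.≟ k) (map (outside ∷ᵛ_) Ss) _))
  (trans (length-++ (filter _ (map (outside ∷ᵛ_) Ss)))
  (trans (cong₂ ℕ._+_
           (trans (length-filter-map (λ S → ∣ S ∣ ℕ.≟ k) (outside ∷ᵛ_) Ss)
                  (length-filter-allSubsets n k))
           (length-filter-map (λ S → ∣ S ∣ ℕ.≟ k) (inside ∷ᵛ_) Ss))
         (pascal k)))
  where
  Ss = allSubsets n

  -- The first summand counts the subsets that omit the first vertex, the second those that contain
  -- it.
  pascal : ∀ k → n C k ℕ.+ length (filter (λ S → suc ∣ S ∣ ℕ.≟ k) Ss)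
                 ≡ suc n C k
  pascal zero    = cong ((n C 0) ℕ.+_) (cong length
    (filter-none (λ S → suc ∣ S ∣ ℕ.≟ 0) {Ss} (universal (λ _ ()) Ss)))
  pascal (suc k) = trans
    (cong ((n C suc k) ℕ.+_) (trans
      (cong length (filter-≐ (λ S → suc ∣ S ∣ ℕ.≟ suc k) (λ S → ∣ S ∣ ℕ.≟ k)
                             (ℕ.suc-injective , cong suc) Ss))
      (length-filter-allSubsets n k)))
    (trans (ℕ.+-comm (n C suc k) (n C k)) (nCk+nC[k+1]≡[n+1]C[k+1] n k))

-- Auxiliary facts on lists, subsets and vectors.

length≡suc⇒∃∈ : ∀ {A : Set} (xs : List A) {k} → length xs ≡ suc k →
                 ∃ (_∈ᴸ xs)
length≡suc⇒∃∈ (x ∷ xs) _ = x , here refl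

x∉p-x : ∀ {n} (p : Subset n) x → x ∉ p - x
x∉p-x (inside  ∷ᵛ p) zero    ()
x∉p-x (outside ∷ᵛ p) zero    ()
x∉p-x (inside  ∷ᵛ p) (suc x) (there x∈) = x∉p-x p x x∈
x∉p-x (outside ∷ᵛ p) (suc x) (there x∈) = x∉p-x p x x∈

x∈p-y⇒x≢y : ∀ {n} {p : Subset n} {x y} → x ∈ p - y → x ≢ y
x∈p-y⇒x≢y {p = p} {x} x∈p-x refl = x∉p-x p x x∈p-x

∣p∣≡0⇒x∉p : ∀ {n} {p : Subset n} {x} → ∣ p ∣ ≡ 0 → x ∉ p
∣p∣≡0⇒x∉p {p = p} {x} ∣p∣≡0 x∈p =
  ℕ.n≮0 (subst (∣ p - x ∣ ℕ.<_) ∣p∣≡0 (x∈p⇒∣p-x∣<∣p∣ x∈p))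

∷ᶠ-injective : ∀ {A : Set} {m} {x : A} {f : Vector A m} →
  (∀ i → f i ≢ x) → Injective _≡_ _≡_ f → Injective _≡_ _≡_ (x ∷ᶠ f)
∷ᶠ-injective f≢x f-inj {zero}  {zero}  eq = refl
∷ᶠ-injective f≢x f-inj {zero}  {suc j} eq = contradiction (sym eq) (f≢x j)
∷ᶠ-injective f≢x f-inj {suc i} {zero}  eq = contradiction eq (f≢x i)
∷ᶠ-injective f≢x f-inj {suc i} {suc j} eq = cong suc (f-inj eq)

-- Forts and skew zero forcing.

module _ {n : ℕ} (G : Graph n) where
  open Graph G renaming (sym to ~-sym)

  -- The forcing condition with the white set replaced by an arbitrary `T`. A nonempty `T` is a fort
  -- exactly when no pair satisfies this.
  Isolates : Subset n → Fin n → Fin n → Set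
  Isolates T v w = v ~ w × w ∈ T × (∀ x → v ~ x → x ∈ T → x ≡ w)

  -- No fort in the subgraph induced by R, stated positively.
  FortFree : Subset n → Set
  FortFree R = ∀ T → T ⊆ R → Nonempty T → ∃₂ λ v w → v ∈ R × Isolates T v w

  -- Consider the first step of the run that colours a vertex of `T`. Until then `T` is entirely
  -- white, so the forcing vertex has no other neighbour in `T`.
  zeroForcing⇒isolates : ∀ {S} → SkewZeroForcing G S →
    ∀ T → (∀ {x} → x ∈ T → x ∉ S) → Nonempty T → ∃₂ (Isolates T)
  zeroForcing⇒isolates Star.ε T disjoint (_ , x∈T) =
    contradiction ∈⊤ (disjoint x∈T)
  zeroForcing⇒isolates {S} (step {v} {w} (v~w , w∉S , unique) Star.◅ r)
    T disjoint T≢∅ with w ∈? T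
  ... | yes w∈T = v , w , v~w , w∈T , λ x v~x x∈T → unique x v~x (disjoint x∈T)
  ... | no  w∉T = zeroForcing⇒isolates r T disjoint′ T≢∅
    where
    disjoint′ : ∀ {x} → x ∈ T → x ∉ S ∪ ⁅ w ⁆
    disjoint′ x∈T x∈S∪w with x∈p∪q⁻ S ⁅ w ⁆ x∈S∪w
    ... | inj₁ x∈S = disjoint x∈T x∈S
    ... | inj₂ x∈w = w∉T (subst (_∈ T) (x∈⁅y⁆⇒x≡y w x∈w) x∈T)

  -- A pair that isolates in `∁ S` is a force available at `S`, so the process stalls only at `⊤`.
  isolates⇒zeroForcing : (∀ T → Nonempty T → ∃₂ (Isolates T)) →
                         ∀ S → SkewZeroForcing G S
  isolates⇒zeroForcing isolate S = go S (⊃-wellFounded S)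
    where
    go : ∀ S → Acc _⊃_ S → SkewZeroForcing G S
    go S (acc rec) with nonempty? (∁ S)
    ... | no ∁S≡∅ = subst (SkewZeroForcing G)
      (⊆-antisym (λ _ → x∉∁p⇒x∈p λ x∈∁S → ∁S≡∅ (_ , x∈∁S)) ⊆⊤) Star.ε
    ... | yes ∁S≢∅ with isolate (∁ S) ∁S≢∅
    ...   | v , w , v~w , w∈∁S , unique =
      step (v~w , w∉S , λ x v~x x∉S → unique x v~x (x∉p⇒x∈∁p x∉S)) Star.◅
      go (S ∪ ⁅ w ⁆)
         (rec (p⊆p∪q ⁅ w ⁆ , w , q⊆p∪q S ⁅ w ⁆ (x∈⁅x⁆ w) , w∉S))
      where
      w∉S : w ∉ S
      w∉S = x∈∁p⇒x∉p w∈∁S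

  -- From the absence of forts to an ordering.

  -- A vertex of `R` that isolates in `T` serves again unless it was deleted. It cannot be `v`,
  -- whose only neighbour in `R` is `w`, outside `T`. If it is `w`, then `T ∪ ⁅ v ⁆` supplies a
  -- replacement.
  fortFree-delete : ∀ {R v w} → v ∈ R → Isolates R v w → FortFree R →
                    FortFree (R - v - w)
  fortFree-delete {R} {v} {w} v∈R (v~w , w∈R , unique) free T T⊆ T≢∅ =
    first (free T T⊆R T≢∅)
    where
    R-v⊆R : R - v ⊆ R
    R-v⊆R = p─q⊆p R ⁅ v ⁆

    T⊆R : T ⊆ R
    T⊆R x∈T = R-v⊆R (p─q⊆p (R - v) ⁅ w ⁆ (T⊆ x∈T))

    w∉T : w ∉ T
    w∉T w∈T = x∈p-y⇒x≢y (T⊆ w∈T) refl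

    v∉T : v ∉ T
    v∉T v∈T = x∈p-y⇒x≢y (p─q⊆p (R - v) ⁅ w ⁆ (T⊆ v∈T)) refl

    remains : ∀ {x} → x ∈ R → x ≢ v → x ≢ w → x ∈ R - v - w
    remains x∈R x≢v x≢w = x∈p∧x≢y⇒x∈p-y (x∈p∧x≢y⇒x∈p-y x∈R x≢v) x≢w

    Goal : Set
    Goal = ∃₂ λ v′ w′ → v′ ∈ R - v - w × Isolates T v′ w′

    -- If w has exactly one neighbour y in T, then it has the two neighbours y
    -- and v in T ∪ {v}, so another vertex must isolate one in T ∪ {v}.
    second : ∀ {y} → w ~ y → y ∈ T → Goal
    second {y} w~y y∈T
      with free (T ∪ ⁅ v ⁆) T∪v⊆R (v , q⊆p∪q T ⁅ v ⁆ (x∈⁅x⁆ v))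
      where
      T∪v⊆R : T ∪ ⁅ v ⁆ ⊆ R
      T∪v⊆R x∈ with x∈p∪q⁻ T ⁅ v ⁆ x∈
      ... | inj₁ x∈T = T⊆R x∈T
      ... | inj₂ x∈v = subst (_∈ R) (sym (x∈⁅y⁆⇒x≡y v x∈v)) v∈R
    ... | v′ , w′ , v′∈R , v′~w′ , w′∈T∪v , unique′ =
      v′ , w′ , remains v′∈R v′≢v v′≢w , v′~w′ , w′∈T ,
      λ x v′~x x∈T → unique′ x v′~x (p⊆p∪q ⁅ v ⁆ x∈T)
      where
      w≢v : w ≢ v
      w≢v w≡v = irrefl (sym w≡v) v~w

      v′≢w : v′ ≢ w
      v′≢w refl = v∉T (subst (_∈ T) (trans
        (unique′ y w~y (p⊆p∪q ⁅ v ⁆ y∈T))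
        (sym (unique′ v (~-sym v~w) (q⊆p∪q T ⁅ v ⁆ (x∈⁅x⁆ v))))) y∈T)

      w′∈T : w′ ∈ T
      w′∈T with x∈p∪q⁻ T ⁅ v ⁆ w′∈T∪v
      ... | inj₁ w′∈T = w′∈T
      ... | inj₂ w′∈v = contradiction
        -- Here `w′` is `v`, so `v′` is a neighbour of `v` in `R` and would have to be `w`.
        (unique v′ (~-sym (subst (v′ ~_) (x∈⁅y⁆⇒x≡y v w′∈v) v′~w′)) v′∈R) v′≢w

      v′≢v : v′ ≢ v
      v′≢v refl = w∉T (subst (_∈ T) (unique w′ v′~w′ (T⊆R w′∈T)) w′∈T)

    first : (∃₂ λ v′ w′ → v′ ∈ R × Isolates T v′ w′) → Goal
    first (v′ , w′ , v′∈R , iso@(v′~w′ , w′∈T , _)) with v′ ≟ v | v′ ≟ w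
    ... | yes refl | _ =
      contradiction (subst (_∈ T) (unique w′ v′~w′ (T⊆R w′∈T)) w′∈T) w∉T
    ... | no v′≢v | no v′≢w = v′ , w′ , remains v′∈R v′≢v v′≢w , iso
    ... | no _    | yes refl = second v′~w′ w′∈T

  -- The orderability condition for the subgraph induced by `R`, so that deletion of a pair can be
  -- inducted on. Bijectivity is split into separate fields, which extend one pair at a time.
  record OrderingOf (R : Subset n) : Set where
    field
      {m}         : ℕ
      u w         : Fin m → Fin n
      u∈R         : ∀ i → u i ∈ R
      w∈R         : ∀ i → w i ∈ R
      u-injective : Injective _≡_ _≡_ u
      w-injective : Injective _≡_ _≡_ w
      u≢w         : ∀ i j → u i ≢ w j
      covers      : ∀ {x} → x ∈ R → ∃ λ s → [ u , w ]′ s ≡ x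
      u-nbrs      : ∀ i {x} → x ∈ R → u i ~ x → ∃ λ j → j ≤ i × x ≡ w j
      matched     : ∀ i → u i ~ w i

  empty-ordering : ∀ {R} → ¬ Nonempty R → OrderingOf R
  empty-ordering R≡∅ = record
    { m = 0 ; u = λ () ; w = λ () ; u∈R = λ () ; w∈R = λ ()
    ; u-injective = λ {} ; w-injective = λ {} ; u≢w = λ ()
    ; covers = λ x∈R → contradiction (_ , x∈R) R≡∅
    ; u-nbrs = λ () ; matched = λ ()
    }

  -- The new pair takes index 0. This suits `v`, which sees only `w` in `R`, and lets every later
  -- `u i` see `w`.
  cons-ordering : ∀ {R v w} → v ∈ R → Isolates R v w →
                  OrderingOf (R - v - w) → OrderingOf R
  cons-ordering {R} {v} {w} v∈R (v~w , w∈R , unique) O = record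
    { u = u ; w = w′ ; u∈R = u∈R ; w∈R = w′∈R
    ; u-injective = ∷ᶠ-injective (λ i → remains⇒≢v (O.u∈R i)) O.u-injective
    ; w-injective = ∷ᶠ-injective (λ i → x∈p-y⇒x≢y (O.w∈R i)) O.w-injective
    ; u≢w = u≢w ; covers = covers ; u-nbrs = u-nbrs ; matched = matched
    }
    where
    module O = OrderingOf O

    u w′ : Fin (suc O.m) → Fin n
    u  = v ∷ᶠ O.u
    w′ = w ∷ᶠ O.w

    remains⇒∈R-v : ∀ {x} → x ∈ R - v - w → x ∈ R - v
    remains⇒∈R-v = p─q⊆p (R - v) ⁅ w ⁆

    remains⇒∈R : ∀ {x} → x ∈ R - v - w → x ∈ R
    remains⇒∈R x∈ = p─q⊆p R ⁅ v ⁆ (remains⇒∈R-v x∈)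

    remains⇒≢v : ∀ {x} → x ∈ R - v - w → x ≢ v
    remains⇒≢v x∈ = x∈p-y⇒x≢y (remains⇒∈R-v x∈)

    u∈R : ∀ i → u i ∈ R
    u∈R zero    = v∈R
    u∈R (suc i) = remains⇒∈R (O.u∈R i)

    w′∈R : ∀ i → w′ i ∈ R
    w′∈R zero    = w∈R
    w′∈R (suc i) = remains⇒∈R (O.w∈R i)

    u≢w : ∀ i j → u i ≢ w′ j
    u≢w zero    zero    v≡w = irrefl v≡w v~w
    u≢w zero    (suc j) v≡  = remains⇒≢v (O.w∈R j) (sym v≡)
    u≢w (suc i) zero    ≡w  = x∈p-y⇒x≢y (O.u∈R i) ≡w
    u≢w (suc i) (suc j)     = O.u≢w i j

    covers : ∀ {x} → x ∈ R → ∃ λ s → [ u , w′ ]′ s ≡ x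
    covers {x} x∈R with x ≟ v | x ≟ w
    ... | yes x≡v | _       = inj₁ zero , sym x≡v
    ... | no _    | yes x≡w = inj₂ zero , sym x≡w
    ... | no x≢v  | no x≢w
      with O.covers (x∈p∧x≢y⇒x∈p-y (x∈p∧x≢y⇒x∈p-y x∈R x≢v) x≢w)
    ...   | inj₁ i , eq = inj₁ (suc i) , eq
    ...   | inj₂ i , eq = inj₂ (suc i) , eq

    u-nbrs : ∀ i {x} → x ∈ R → u i ~ x → ∃ λ j → j ≤ i × x ≡ w′ j
    u-nbrs zero    {x} x∈R v~x = zero , z≤n , unique x v~x x∈R
    u-nbrs (suc i) {x} x∈R u~x with x ≟ w
    ... | yes x≡w = zero , z≤n , x≡w
    ... | no  x≢w with O.u-nbrs i
      (x∈p∧x≢y⇒x∈p-y (x∈p∧x≢y⇒x∈p-y x∈R x≢v) x≢w) u~x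
      where
      x≢v : x ≢ v
      -- A later `u` adjacent to `v` would be a neighbour of `v` in `R`, hence the deleted `w`.
      x≢v x≡v = x∈p-y⇒x≢y (O.u∈R i)
        (unique (O.u i) (~-sym (subst (O.u i ~_) x≡v u~x)) (u∈R (suc i)))
    ...   | j , j≤i , x≡wj = suc j , s≤s j≤i , x≡wj

    matched : ∀ i → u i ~ w′ i
    matched zero    = v~w
    matched (suc i) = O.matched i

  fortFree⇒ordering : ∀ R → FortFree R → OrderingOf R
  fortFree⇒ordering R = go R (⊂-wellFounded R)
    where
    go : ∀ R → Acc _⊂_ R → FortFree R → OrderingOf R
    go R (acc rec) free with nonempty? R
    ... | no  R≡∅ = empty-ordering R≡∅
    -- Applied to `R` itself, fort-freeness gives a vertex of `R` with a unique neighbour in `R`.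
    ... | yes R≢∅ with free R ⊆-refl R≢∅
    ...   | v , w , v∈R , iso = cons-ordering v∈R iso
      (go (R - v - w)
          (rec (⊆-⊂-trans (p─q⊆p (R - v) ⁅ w ⁆) (x∈p⇒p-x⊂p v∈R)))
          (fortFree-delete v∈R iso free))

  ordering⇒orderable : OrderingOf ⊤ → TwoSetPerfectlyOrderable G
  ordering⇒orderable O = record
    { u = u ; w = w
    ; partition = injective , λ x → let s , eq = covers {x} ∈⊤ in
        s , λ { refl → eq }
    ; u-nbrs = λ i x → u-nbrs i ∈⊤
    ; matched = matched
    }
    where
    open OrderingOf O

    injective : Injective _≡_ _≡_ [ u , w ]′
    injective {inj₁ i} {inj₁ j} eq = cong inj₁ (u-injective eq)
    injective {inj₁ i} {inj₂ j} eq = contradiction eq (u≢w i j)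
    injective {inj₂ i} {inj₁ j} eq = contradiction (sym eq) (u≢w j i)
    injective {inj₂ i} {inj₂ j} eq = cong inj₂ (w-injective eq)

  -- From an ordering to the absence of forts.

  orderable⇒isolates : TwoSetPerfectlyOrderable G →
                       ∀ T → Nonempty T → ∃₂ (Isolates T)
  orderable⇒isolates O T (x , x∈T) with proj₂ partition x
    where open TwoSetPerfectlyOrderable O
  ... | s , hit = cover s (subst (_∈ T) (sym (hit refl)) x∈T)
    where
    open TwoSetPerfectlyOrderable O

    from-w : ∀ i → Acc _<_ i → w i ∈ T → ∃₂ (Isolates T)
    from-w i (acc rec) wi∈T with any? (λ j → (j <? i) ×-dec (w j ∈? T))
    ... | yes (j , j<i , wj∈T) = from-w j (rec j<i) wj∈T
    ... | no  least = u i , w i , matched i , wi∈T , unique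
      where
      unique : ∀ y → u i ~ y → y ∈ T → y ≡ w i
      unique y u~y y∈T with u-nbrs i y u~y
      -- A neighbour `w j` in `T` has `j ≤ i`, and minimality of `i` excludes `j < i`.
      ... | j , j≤i , refl with j ≟ i
      ...   | yes j≡i = cong w j≡i
      ...   | no  j≢i = contradiction (j , ≤∧≢⇒< j≤i j≢i , y∈T) least

    from-u : (∀ j → w j ∉ T) → ∀ i → Acc _>_ i → u i ∈ T → ∃₂ (Isolates T)
    from-u w∉T i (acc rec) ui∈T with any? (λ j → (i <? j) ×-dec (u j ∈? T))
    ... | yes (j , i<j , uj∈T) = from-u w∉T j (rec i<j) uj∈T
    ... | no  greatest = w i , u i , ~-sym (matched i) , ui∈T , unique
      where
      unique : ∀ y → w i ~ y → y ∈ T → y ≡ u i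
      unique y w~y y∈T with proj₂ partition y
      ... | inj₂ k , hit =
        contradiction (subst (_∈ T) (sym (hit refl)) y∈T) (w∉T k)
      ... | inj₁ k , hit with refl ← hit refl
        with u-nbrs k (w i) (~-sym w~y)
      -- Injectivity identifies `j` with `i`, so `i ≤ k`; as `i` is greatest with `u i ∈ T`, only
      -- `k = i` remains.
      ...   | j , j≤k , wi≡wj with refl ← proj₁ partition {inj₂ i} {inj₂ j} wi≡wj
        with i ≟ k
      ...     | yes i≡k = cong u (sym i≡k)
      ...     | no  i≢k = contradiction (k , ≤∧≢⇒< j≤k i≢k , y∈T) greatest

    cover : ∀ s → [ u , w ]′ s ∈ T → ∃₂ (Isolates T)
    cover (inj₂ i) wi∈T = from-w i (<-wellFounded i) wi∈T
    cover (inj₁ i) ui∈T with any? (λ j → w j ∈? T)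
    ... | yes (j , wj∈T) = from-w j (<-wellFounded j) wj∈T
    ... | no  ∄w = from-u (λ j wj∈T → ∄w (j , wj∈T)) i (>-wellFounded i) ui∈T

  -- Passing between the polynomial and orderability.

  -- Emptiness of `S` is stated through its size because counting yields it in that form.
  zeroForcing⇒orderable : ∀ {S} → ∣ S ∣ ≡ 0 → SkewZeroForcing G S →
                          TwoSetPerfectlyOrderable G
  zeroForcing⇒orderable ∣S∣≡0 zf = ordering⇒orderable
    (fortFree⇒ordering ⊤ λ T _ T≢∅ →
      let v , w , iso = zeroForcing⇒isolates zf T (λ _ → ∣p∣≡0⇒x∉p ∣S∣≡0) T≢∅
      in v , w , ∈⊤ , iso)

  -- The constant coefficient suffices: its value 1 says that some set of size 0 is skew zero
  -- forcing.
  polynomial⇒orderable : 𝒵⁻ G ≈ (X + const 1) ^ n → TwoSetPerfectlyOrderable G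
  polynomial⇒orderable 𝒵⁻≈ =
    let z⁻₀≡1 = trans (sym (coeff-sum (suc n) (z⁻ G) 0 λ ()))
                      (trans (𝒵⁻≈ 0) (binomial n 0))
        S , S∈ = length≡suc⇒∃∈ _ z⁻₀≡1
        _ , zf , ∣S∣≡0 = ∈-filter⁻
          (λ S → skewZeroForcing? G S ×-dec (∣ S ∣ ℕ.≟ 0)) {xs = allSubsets n} S∈
    in zeroForcing⇒orderable ∣S∣≡0 zf

  -- Every subset is forcing here, so the filter tests cardinality alone.
  orderable⇒z⁻ : TwoSetPerfectlyOrderable G → ∀ k → z⁻ G k ≡ n C k
  orderable⇒z⁻ O k = trans
    (cong length (filter-≐ _ (λ S → ∣ S ∣ ℕ.≟ k)
      (proj₂ , λ {S} → isolates⇒zeroForcing (orderable⇒isolates O) S ,_)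
      (allSubsets n)))
    (length-filter-allSubsets n k)

corollary10 : ∀ {n : ℕ} (G : Graph n) →
    (∑[ n ] (λ i → n C i) Xⁱ ≈ (X + const 1) ^ n) ×
    (𝒵⁻ G ≈ (X + const 1) ^ n ⇔ TwoSetPerfectlyOrderable G)
corollary10 {n} G =
  ∑-≈-binomial n (n C_) (λ _ → refl) ,
  mk⇔ (polynomial⇒orderable G)
      (λ O → ∑-≈-binomial n (z⁻ G) (orderable⇒z⁻ G O))
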